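{- An algebraic lattice $L$ is a convexity lattice if and only if $L$ is spatial and for every $y\in L$ and all completely join-irreducible elements $u,v$ of $L$, the condition $y<y\vee u=y\vee v$ implies $u=v$.
   Context: A convexity lattice is a lattice isomorphic to the lattice of closed sets (ordered by inclusion) of a convex geometry $(X,\varphi)$: $\varphi$ is a closure operator on a non-empty set $X$ with $\varphi(\emptyset)=\emptyset$ such that for every closed $A$ and $x\neq y$ in $X$, $x\in\varphi(A\cup\{y\})$ and $x\notin A$ imply $y\notin\varphi(A\cup\{x\})$. An algebraic lattice is a complete lattice in which every element is a join of compact elements. An element $y$ is completely join-irreducible if it has a lower cover $y_*$ such that $z<y$ implies $z\leq y_*$; $L$ is spatial if every element is a join of completely join-irreducible elements.
   Formalization: The lattice L is assumed to have at least two elements: the one-element lattice is algebraic, spatial and satisfies the condition vacuously, but it is not a convexity lattice since X is non-empty and φ(∅)=∅. -}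

module Defs where

open import Level using (Level; _⊔_; suc)
open import Data.List.Base using (List)
open import Data.List.Membership.Propositional using () renaming (_∈_ to _∈ˡ_)
open import Data.List.Relation.Unary.All using (All)
open import Data.Product.Base using (Σ; Σ-syntax; ∃; ∃-syntax; ∃₂; _×_; _,_; proj₁; proj₂)
open import Data.Sum.Base using (inj₁; inj₂; [_,_])
open import Function.Base using (_on_)
open import Relation.Binary.Core using (Rel)
open import Relation.Binary.Bundles using (Setoid)
open import Relation.Binary.Definitions using (_Respects_)
open import Relation.Binary.Lattice using (Lattice)
open import Relation.Nullary.Negation.Core using (¬_)
open import Relation.Unary using (Pred; _∈_; _∉_; _⊆_; _≐_; _∪_; _∩_)
open import Relation.Unary.Polymorphic using (∅)
import Relation.Unary.Properties as Unary
import Algebra.Lattice.Bundles as Alg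
open import Algebra.Lattice.Morphism.Structures using (module LatticeMorphisms)
open import Relation.Binary.Lattice.Properties.Lattice using (algLattice)
import Relation.Binary.Properties.Poset as PosetProperties

-- Sets are setoids.  φ is given on all predicates, including those that do
-- not respect _≈_, but its values respect _≈_.  Hence φ A = φ Â for Â the
-- ≈-saturation of A, closed sets respect _≈_, and φ is determined by its
-- action on genuine subsets of the setoid.
record ConvexGeometry (ℓ : Level) : Set (suc ℓ) where
  field
    X : Setoid ℓ ℓ
  open Setoid X public
  field
    nonEmpty   : Carrier
    φ          : Pred Carrier ℓ → Pred Carrier ℓ
    φ-resp     : ∀ A → φ A Respects _≈_
    extensive  : ∀ A → A ⊆ φ A
    monotone   : ∀ A B → A ⊆ B → φ A ⊆ φ B
    idempotent : ∀ A → φ (φ A) ≐ φ A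
    φ-∅        : φ ∅ ≐ ∅ {ℓ = ℓ}

  ｛_｝ : Carrier → Pred Carrier ℓ
  ｛ x ｝ z = z ≈ x

  Closed : Pred (Pred Carrier ℓ) ℓ
  Closed A = φ A ≐ A

  field
    antiExchange : ∀ A → Closed A → ∀ x y → ¬ (x ≈ y) →
                   x ∈ φ (A ∪ ｛ y ｝) → x ∉ A → y ∉ φ (A ∪ ｛ x ｝)

module _ {ℓ : Level} (G : ConvexGeometry ℓ) where
  open ConvexGeometry G

  ClosedSet : Set (suc ℓ)
  ClosedSet = Σ (Pred Carrier ℓ) Closed

  closedSets : Lattice (suc ℓ) ℓ ℓ
  closedSets = record
    { Carrier   = ClosedSet
    ; _≈_       = _≐_ on proj₁
    ; _≤_       = _⊆_ on proj₁
    ; _∨_       = λ (A , _) (B , _) → φ (A ∪ B) , idempotent (A ∪ B)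
    ; _∧_       = λ (A , cA) (B , cB) → A ∩ B
        , (λ p → proj₁ cA (monotone (A ∩ B) A proj₁ p)
               , proj₁ cB (monotone (A ∩ B) B proj₂ p))
        , extensive (A ∩ B)
    ; isLattice = record
      { isPartialOrder = record
        { isPreorder = record
          { isEquivalence = record
            { refl  = (λ p → p) , (λ p → p)
            ; sym   = Unary.≐-sym
            ; trans = Unary.≐-trans
            }
          ; reflexive = proj₁
          ; trans     = λ A⊆B B⊆C p → B⊆C (A⊆B p)
          }
        ; antisym = _,_
        }
      ; supremum = λ (A , _) (B , _) →
            (λ p → extensive (A ∪ B) (inj₁ p))
          , (λ p → extensive (A ∪ B) (inj₂ p))
          , λ (C , cC) A⊆C B⊆C p →
              proj₁ cC (monotone (A ∪ B) C [ A⊆C , B⊆C ] p)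
      ; infimum = λ _ _ → proj₁ , proj₂ , λ _ C⊆A C⊆B p → C⊆A p , C⊆B p
      }
    }

module _ {c₁ a₁ b₁ c₂ a₂ b₂ : Level}
         (L : Lattice c₁ a₁ b₁) (M : Lattice c₂ a₂ b₂) where
  private
    module L = Lattice L
    module M = Lattice M

  LatticeIsomorphic : Set (c₁ ⊔ a₁ ⊔ c₂ ⊔ a₂)
  LatticeIsomorphic = Σ[ f ∈ (L.Carrier → M.Carrier) ] IsLatticeIsomorphism f
    where open LatticeMorphisms (Alg.Lattice.rawLattice (algLattice L))
                                (Alg.Lattice.rawLattice (algLattice M))

module LatticeNotions {c ℓ₁ ℓ₂ : Level} (L : Lattice c ℓ₁ ℓ₂) where
  open Lattice L
  open PosetProperties poset public using (_<_)

  infix 4 _≤⋁_ _⋖_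

  -- The universe level of subsets of L, and of geometries representing L.
  -- It bounds no cardinality: in a convex geometry x ↦ φ {x} is injective,
  -- so X is never larger than the lattice of closed sets.
  ℓL : Level
  ℓL = c ⊔ ℓ₁ ⊔ ℓ₂

  IsConvexityLattice : Set (suc ℓL)
  IsConvexityLattice = Σ[ G ∈ ConvexGeometry ℓL ] LatticeIsomorphic L (closedSets G)

  IsJoin : ∀ {s} → Pred Carrier s → Carrier → Set (c ⊔ ℓ₂ ⊔ s)
  IsJoin S j = (∀ z → z ∈ S → z ≤ j) × (∀ b → (∀ z → z ∈ S → z ≤ b) → j ≤ b)

  IsMeet : ∀ {s} → Pred Carrier s → Carrier → Set (c ⊔ ℓ₂ ⊔ s)
  IsMeet S m = (∀ z → z ∈ S → m ≤ z) × (∀ b → (∀ z → z ∈ S → b ≤ z) → b ≤ m)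

  _≤⋁_ : ∀ {s} → Carrier → Pred Carrier s → Set (c ⊔ ℓ₂ ⊔ s)
  k ≤⋁ S = ∃[ j ] IsJoin S j × k ≤ j

  IsComplete : Set (suc ℓL)
  IsComplete = (S : Pred Carrier ℓL) → ∃ (IsJoin S) × ∃ (IsMeet S)

  IsCompact : Carrier → Set (suc ℓL)
  IsCompact k = (S : Pred Carrier ℓL) → k ≤⋁ S →
                Σ[ xs ∈ List Carrier ] All (_∈ S) xs × k ≤⋁ (_∈ˡ xs)

  JoinGeneratedBy : ∀ {s} → Pred Carrier s → Set (suc ℓL ⊔ s)
  JoinGeneratedBy P = ∀ y → Σ[ S ∈ Pred Carrier ℓL ] S ⊆ P × IsJoin S y

  IsAlgebraic : Set (suc ℓL)
  IsAlgebraic = IsComplete × JoinGeneratedBy IsCompact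

  _⋖_ : Rel Carrier ℓL
  x ⋖ y = x < y × (∀ z → ¬ (x < z × z < y))

  IsCompletelyJoinIrreducible : Carrier → Set ℓL
  IsCompletelyJoinIrreducible y = ∃[ y⁎ ] y⁎ ⋖ y × (∀ z → z < y → z ≤ y⁎)

  IsSpatial : Set (suc ℓL)
  IsSpatial = JoinGeneratedBy IsCompletelyJoinIrreducible

  -- The one-element lattice is algebraic and vacuously satisfies the
  -- irreducible-element criterion, but it is not the lattice of closed sets
  -- of a geometry, as φ ∅ = ∅ ≠ X.
  IsNontrivial : Set (c ⊔ ℓ₁)
  IsNontrivial = ∃₂ λ x y → ¬ (x ≈ y)

{-# OPTIONS --safe #-}

-- A geometry representing L amounts to a set P of nonzero elements of L, its
-- points, such that every element is the join of the points below it and the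
-- anti-exchange law holds for points.  Every completely join-irreducible
-- element is a point, so anti-exchange gives the criterion; conversely, if L
-- is spatial, the completely join-irreducible elements can serve as points.
--
-- What remains is that points force L to be spatial.  Suppose b ≰ a, and take
-- a compact k ≤ b with k ≰ a.  Adjoining to a, one by one, finitely many
-- points with join above k, we reach some c ≥ a and a point x ≤ k with k ≰ c
-- and k ≤ c ∨ x.  By anti-exchange, adjoining to c finitely many points of
-- c ∨ x other than x never captures x, hence never captures k; as k is
-- compact, x is not below the join m of all those points.  So x ∧ m is the
-- lower cover of x, and x is a completely join-irreducible element with
-- x ≤ b and x ≰ a.

module Submission where

open import Defs
import Algebra.Lattice.Bundles as Alg
open import Algebra.Lattice.Morphism.Structures using (module LatticeMorphisms)
open import Axiom.ExcludedMiddle using (ExcludedMiddle)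
open import Data.Empty using (⊥-elim)
open import Data.List.Base using (List; []; _∷_; foldr)
open import Data.List.Membership.Propositional using () renaming (_∈_ to _∈ˡ_)
open import Data.List.Relation.Unary.All using (All; []; _∷_)
open import Data.List.Relation.Unary.Any using (here; there)
open import Data.Product.Base using (Σ; Σ-syntax; ∃-syntax; _×_; _,_; proj₁; proj₂)
open import Data.Sum.Base using (inj₁; inj₂; [_,_])
open import Function.Base using (_∘_)
open import Function.Bundles using (_⇔_; mk⇔)
open import Level using (Lift; lift; lower)
open import Relation.Binary.Lattice using (Lattice)
open import Relation.Binary.Lattice.Properties.Lattice using (algLattice)
open import Relation.Binary.PropositionalEquality.Core using () renaming (refl to ≡-refl)
open import Relation.Nullary using (¬_; yes; no)
open import Relation.Nullary.Decidable using (decidable-stable)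
open import Relation.Unary using (Pred; _∈_; _⊆_; _≐_; _∪_)
open import Relation.Unary.Polymorphic using (∅)

-- Join-dense sets, anti-exchange and finite joins in a lattice.

module _ {c ℓ₁ ℓ₂} (L : Lattice c ℓ₁ ℓ₂) where
  open Lattice L
  open LatticeNotions L

  JoinDense : Pred Carrier ℓL → Set ℓL
  JoinDense P = ∀ a b → (∀ z → z ∈ P → z ≤ a → z ≤ b) → a ≤ b

  AntiExchange : Pred Carrier ℓL → Set ℓL
  AntiExchange P = ∀ a x y → x ∈ P → y ∈ P →
    ¬ x ≤ a → x ≤ a ∨ y → y ≤ a ∨ x → x ≈ y

  -- Excludes a least element without naming one; this is what makes `φ ∅` empty.
  HasNonLeast : Pred Carrier ℓL → Set ℓL
  HasNonLeast P = ∀ x → x ∈ P → ∃[ y ] ¬ x ≤ y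

  PointsBelow : Pred Carrier ℓL → Carrier → Pred Carrier ℓL
  PointsBelow P a z = z ∈ P × z ≤ a

  IrreducibleExchange : Set ℓL
  IrreducibleExchange =
    ∀ y u v → IsCompletelyJoinIrreducible u → IsCompletelyJoinIrreducible v →
    y < (y ∨ u) → (y ∨ u) ≈ (y ∨ v) → u ≈ v

  ∨-least′ : ∀ {a b d} → a ≤ d → b ≤ d → a ∨ b ≤ d
  ∨-least′ {a} {b} {d} = proj₂ (proj₂ (supremum a b)) d

  pointsBelow-join : ∀ {P} → JoinDense P → ∀ a → IsJoin (PointsBelow P a) a
  pointsBelow-join dense a =
    (λ _ → proj₂) , λ b ub → dense a b (λ z z∈P z≤a → ub z (z∈P , z≤a))

  ≤-foldr-∨ : ∀ e xs {x} → x ∈ˡ xs → x ≤ foldr _∨_ e xs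
  ≤-foldr-∨ e (x ∷ xs) (here ≡-refl) = x≤x∨y x _
  ≤-foldr-∨ e (x ∷ xs) (there x∈xs) = trans (≤-foldr-∨ e xs x∈xs) (y≤x∨y x _)

  base≤foldr-∨ : ∀ e xs → e ≤ foldr _∨_ e xs
  base≤foldr-∨ e [] = refl
  base≤foldr-∨ e (x ∷ xs) = trans (base≤foldr-∨ e xs) (y≤x∨y x _)

  -- The start `e` of the fold only enlarges it, so any choice works; it will be the element to
  -- which points are adjoined.
  compact-finite : ∀ {k} → IsCompact k → ∀ {S j} → IsJoin S j → k ≤ j → ∀ e →
                   Σ[ xs ∈ List Carrier ] All (_∈ S) xs × k ≤ foldr _∨_ e xs
  compact-finite k-compact {S} {j} j-join k≤j e
    with xs , xs⊆S , i , i-join , k≤i ← k-compact S (j , j-join , k≤j) =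
      xs , xs⊆S , trans k≤i (proj₂ i-join _ (λ _ → ≤-foldr-∨ e xs))

  irreducible-nonLeast : HasNonLeast IsCompletelyJoinIrreducible
  irreducible-nonLeast x (x⁎ , ((x⁎≤x , x⁎≉x) , _) , _) =
    x⁎ , λ x≤x⁎ → x⁎≉x (antisym x⁎≤x x≤x⁎)

  spatial⇒dense : IsSpatial → JoinDense IsCompletelyJoinIrreducible
  spatial⇒dense spatial a b below
    with S , S⊆CJI , ub , least ← spatial a =
      least b (λ z z∈S → below z (S⊆CJI z∈S) (ub z z∈S))

  exchange⇒antiExchange : IrreducibleExchange →
                          AntiExchange IsCompletelyJoinIrreducible
  exchange⇒antiExchange exch a x y x-irr y-irr x≰a x≤a∨y y≤a∨x =
    exch a x y x-irr y-irr
      (x≤x∨y a x , λ a≈a∨x → x≰a (trans (y≤x∨y a x) (reflexive (Eq.sym a≈a∨x))))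
      (antisym (∨-least′ (x≤x∨y a y) x≤a∨y) (∨-least′ (x≤x∨y a x) y≤a∨x))

-- Points yield spatiality and the criterion on irreducibles.

module PointsToIrreducibles
  (em : ∀ {ℓ} → ExcludedMiddle ℓ) {c ℓ₁ ℓ₂} (L : Lattice c ℓ₁ ℓ₂)
  where
  open Lattice L
  open LatticeNotions L

  module _ {P : Pred Carrier ℓL} (dense : JoinDense L P) (antiEx : AntiExchange L P) where

    -- Were all points below `u` different from `u`, they would lie below the lower cover `u⁎`, and
    -- density would put `u` there too.
    irreducible⇒point : ∀ {u} → IsCompletelyJoinIrreducible u → ∃[ x ] x ∈ P × x ≈ u
    irreducible⇒point {u} (u⁎ , ((u⁎≤u , u⁎≉u) , _) , below) =
      decidable-stable em λ none →
        u⁎≉u (antisym u⁎≤u (dense u u⁎ λ z z∈P z≤u →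
          below z (z≤u , λ z≈u → none (z , z∈P , z≈u))))

    irreducibleExchange : IrreducibleExchange L
    irreducibleExchange y u v u-irr v-irr (y≤y∨u , y≉y∨u) y∨u≈y∨v
      with x , x∈P , x≈u ← irreducible⇒point u-irr
         | z , z∈P , z≈v ← irreducible⇒point v-irr =
      Eq.trans (Eq.sym x≈u) (Eq.trans (antiEx y x z x∈P z∈P x≰y x≤y∨z z≤y∨x) z≈v)
      where
      x≰y : ¬ x ≤ y
      x≰y x≤y = y≉y∨u (antisym y≤y∨u
        (∨-least′ L refl (trans (reflexive (Eq.sym x≈u)) x≤y)))
      x≤y∨z : x ≤ y ∨ z
      x≤y∨z = trans (reflexive x≈u) (trans (y≤x∨y y u) (trans (reflexive y∨u≈y∨v)
        (∨-least′ L (x≤x∨y y z) (trans (reflexive (Eq.sym z≈v)) (y≤x∨y y z)))))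
      z≤y∨x : z ≤ y ∨ x
      z≤y∨x = trans (reflexive z≈v) (trans (y≤x∨y y v) (trans (reflexive (Eq.sym y∨u≈y∨v))
        (∨-least′ L (x≤x∨y y x) (trans (reflexive (Eq.sym x≈u)) (y≤x∨y y x)))))

    -- `foldr` adjoins points from the end of the list: `x` is the first whose adjunction reaches
    -- `k`, and `e` is the fold just before it.
    first-capture : ∀ {a k} xs → All (PointsBelow L P k) xs →
                    ¬ k ≤ a → k ≤ foldr _∨_ a xs →
                    ∃[ e ] ∃[ x ] a ≤ e × x ∈ P × x ≤ k × ¬ k ≤ e × k ≤ e ∨ x
    first-capture [] [] k≰a k≤a = ⊥-elim (k≰a k≤a)
    first-capture {a} {k} (x ∷ xs) ((x∈P , x≤k) ∷ xs-points) k≰a k≤x∨e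
      with em {P = k ≤ foldr _∨_ a xs}
    ... | yes k≤e = first-capture xs xs-points k≰a k≤e
    ... | no  k≰e = foldr _∨_ a xs , x , base≤foldr-∨ L a xs , x∈P , x≤k , k≰e ,
                    trans k≤x∨e (∨-least′ L (y≤x∨y _ x) (x≤x∨y _ x))

    OtherPointsBelow : Carrier → Carrier → Pred Carrier ℓL
    OtherPointsBelow x d z = z ∈ P × z ≤ d × ¬ z ≈ x

    -- Induction on the list: if `f` misses `x` but `z ∨ f` captures it, then `z ≤ e ∨ x ≤ f ∨ x`,
    -- so anti-exchange at `f` forces `z ≈ x`.
    otherPoints-avoid : ∀ {e x} → x ∈ P → ¬ x ≤ e → ∀ zs →
                        All (OtherPointsBelow x (e ∨ x)) zs → ¬ x ≤ foldr _∨_ e zs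
    otherPoints-avoid x∈P x≰e [] [] = x≰e
    otherPoints-avoid {e} {x} x∈P x≰e (z ∷ zs) ((z∈P , z≤e∨x , z≉x) ∷ zs-others) x≤z∨f =
      z≉x (Eq.sym (antiEx f x z x∈P z∈P
        (otherPoints-avoid x∈P x≰e zs zs-others)
        (trans x≤z∨f (∨-least′ L (y≤x∨y f z) (x≤x∨y f z)))
        (trans z≤e∨x (∨-least′ L (trans (base≤foldr-∨ L e zs) (x≤x∨y f x)) (y≤x∨y f x)))))
      where
      f = foldr _∨_ e zs

    captured-irreducible : IsComplete → ∀ {k e x} → IsCompact k → x ∈ P →
                           x ≤ k → ¬ k ≤ e → k ≤ e ∨ x → IsCompletelyJoinIrreducible x
    captured-irreducible complete {k} {e} {x} k-compact x∈P x≤k k≰e k≤e∨x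
      with (m , m-join) , _ ← complete (OtherPointsBelow x (e ∨ x)) =
      x ∧ m , ((x∧y≤x x m , x∧m≉x) , λ z ((x∧m≤z , x∧m≉z) , z<x) →
        x∧m≉z (antisym x∧m≤z (below z z<x))) , below
      where
      x≰e : ¬ x ≤ e
      x≰e x≤e = k≰e (trans k≤e∨x (∨-least′ L refl x≤e))
      e≤m : e ≤ m
      -- A point below `e` cannot equal `x`, as `x ≰ e`, so it is among those joined in `m`.
      e≤m = dense e m λ z z∈P z≤e → proj₁ m-join z
        (z∈P , trans z≤e (x≤x∨y e x) , λ z≈x → x≰e (trans (reflexive (Eq.sym z≈x)) z≤e))
      x≰m : ¬ x ≤ m
      -- Only `k` is known to be compact, not `x`; but `x ≤ m` gives `k ≤ e ∨ x ≤ m`, so finitely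
      -- many other points reach `k` and with it `x`.
      x≰m x≤m
        with zs , zs-others , k≤f ←
               compact-finite L k-compact m-join (trans k≤e∨x (∨-least′ L e≤m x≤m)) e =
        otherPoints-avoid x∈P x≰e zs zs-others (trans x≤k k≤f)
      x∧m≉x : ¬ (x ∧ m ≈ x)
      x∧m≉x eq = x≰m (trans (reflexive (Eq.sym eq)) (x∧y≤y x m))
      below : ∀ z → z < x → z ≤ x ∧ m
      below z (z≤x , z≉x) = ∧-greatest z≤x (dense z m λ w w∈P w≤z → proj₁ m-join w
        (w∈P , trans w≤z (trans z≤x (y≤x∨y e x)) ,
         λ w≈x → z≉x (antisym z≤x (trans (reflexive (Eq.sym w≈x)) w≤z))))

    separating-compact : JoinGeneratedBy IsCompact → ∀ {a b} → ¬ b ≤ a →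
                         ∃[ k ] IsCompact k × k ≤ b × ¬ k ≤ a
    separating-compact generated {a} {b} b≰a
      with K , K-compact , ub , least ← generated b =
      decidable-stable em λ none → b≰a (least a λ k k∈K →
        decidable-stable em λ k≰a → none (k , K-compact k∈K , ub k k∈K , k≰a))

    separating-irreducible : IsAlgebraic → ∀ {a b} → ¬ b ≤ a →
                             ∃[ x ] IsCompletelyJoinIrreducible x × x ≤ b × ¬ x ≤ a
    separating-irreducible (complete , generated) {a} b≰a
      with k , k-compact , k≤b , k≰a ← separating-compact generated b≰a
      with xs , xs-points , k≤f ←
             compact-finite L k-compact (pointsBelow-join L dense k) refl a
      with e , x , a≤e , x∈P , x≤k , k≰e , k≤e∨x ← first-capture xs xs-points k≰a k≤f =
      x , captured-irreducible complete k-compact x∈P x≤k k≰e k≤e∨x , trans x≤k k≤b ,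
      λ x≤a → k≰e (trans k≤e∨x (∨-least′ L refl (trans x≤a a≤e)))

    spatial : IsAlgebraic → IsSpatial
    spatial algebraic b =
      PointsBelow L IsCompletelyJoinIrreducible b , proj₁ , (λ _ → proj₂) ,
      λ a ub → decidable-stable em λ b≰a →
        let x , x-irr , x≤b , x≰a = separating-irreducible algebraic b≰a
        in x≰a (ub x (x-irr , x≤b))

-- From a representing geometry to points of the lattice.

module GeometryToPoints
  (em : ∀ {ℓ} → ExcludedMiddle ℓ) {c ℓ₁ ℓ₂} (L : Lattice c ℓ₁ ℓ₂)
  (G : ConvexGeometry (LatticeNotions.ℓL L)) (iso : LatticeIsomorphic L (closedSets G))
  where
  open Lattice L
  open LatticeNotions L
  private
    module G = ConvexGeometry G

  open LatticeMorphisms (Alg.Lattice.rawLattice (algLattice L))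
                        (Alg.Lattice.rawLattice (algLattice (closedSets G)))
  open IsLatticeIsomorphism (proj₂ iso)

  f : Carrier → Pred G.Carrier ℓL
  f a = proj₁ (proj₁ iso a)

  f-closed : ∀ a → G.Closed (f a)
  f-closed a = proj₂ (proj₁ iso a)

  f-mono : ∀ {a b} → a ≤ b → f a ⊆ f b
  f-mono {a} {b} a≤b i∈fa =
    proj₁ (⟦⟧-cong {a ∨ b} {b} (antisym (∨-least′ L a≤b refl) (y≤x∨y a b)))
      (proj₂ (∨-homo a b) (G.extensive (f a ∪ f b) (inj₁ i∈fa)))

  f-reflects-≤ : ∀ {a b} → f a ⊆ f b → a ≤ b
  f-reflects-≤ {a} {b} fa⊆fb =
    trans (reflexive (Eq.sym (injective {a ∧ b} {a}
      ( proj₁ ∘ proj₁ (∧-homo a b)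
      , λ i∈fa → proj₂ (∧-homo a b) (i∈fa , fa⊆fb i∈fa)))))
      (x∧y≤y a b)

  -- Translates membership into order: by `point≤` and `point≤⁻¹`, `i ∈ f a` amounts to
  -- `point i ≤ a`.
  point : G.Carrier → Carrier
  point i = proj₁ (surjective (G.φ G.｛ i ｝ , G.idempotent G.｛ i ｝))

  f-point : ∀ i → f (point i) ≐ G.φ G.｛ i ｝
  f-point i = proj₂ (surjective (G.φ G.｛ i ｝ , G.idempotent G.｛ i ｝)) Eq.refl

  i∈f-point : ∀ i → i ∈ f (point i)
  i∈f-point i = proj₂ (f-point i) (G.extensive G.｛ i ｝ G.refl)

  point≤ : ∀ {i a} → i ∈ f a → point i ≤ a
  point≤ {i} {a} i∈fa = f-reflects-≤ λ j∈f-point →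
    proj₁ (f-closed a) (G.monotone G.｛ i ｝ (f a) i⊆fa (proj₁ (f-point i) j∈f-point))
    where
    i⊆fa : G.｛ i ｝ ⊆ f a
    -- `f a` respects `≈` because it equals its closure.
    i⊆fa j≈i = proj₁ (f-closed a)
      (G.φ-resp (f a) (G.sym j≈i) (proj₂ (f-closed a) i∈fa))

  point≤⁻¹ : ∀ {i a} → point i ≤ a → i ∈ f a
  point≤⁻¹ {i} i≤a = f-mono i≤a (i∈f-point i)

  point-cong : ∀ {i j} → i G.≈ j → point i ≈ point j
  point-cong i≈j = antisym (point-mono i≈j) (point-mono (G.sym i≈j))
    where
    point-mono : ∀ {i j} → i G.≈ j → point i ≤ point j
    point-mono {i} {j} i≈j = point≤ (proj₂ (f-point j) (G.extensive G.｛ j ｝ i≈j))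

  -- Both `f a` and `φ ｛ i ｝` lie in the closed set `φ (f a ∪ ｛ i ｝)`, which therefore contains the
  -- closure of their union.
  f-∨-point : ∀ {a} i → f (a ∨ point i) ⊆ G.φ (f a ∪ G.｛ i ｝)
  f-∨-point {a} i j∈f =
    proj₁ (G.idempotent A) (G.monotone (f a ∪ f (point i)) (G.φ A)
      [ G.extensive A ∘ inj₁ , G.monotone G.｛ i ｝ A inj₂ ∘ proj₁ (f-point i) ]
      (proj₁ (∨-homo a (point i)) j∈f))
    where
    A = f a ∪ G.｛ i ｝

  point-antiExchange : ∀ {a i j} → ¬ point i ≤ a → point i ≤ a ∨ point j →
                       point j ≤ a ∨ point i → point i ≈ point j
  point-antiExchange {a} {i} {j} i≰a i≤a∨j j≤a∨i = point-cong (decidable-stable em λ i≉j →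
    G.antiExchange (f a) (f-closed a) i j i≉j (f-∨-point j (point≤⁻¹ i≤a∨j))
      (i≰a ∘ point≤) (f-∨-point i (point≤⁻¹ j≤a∨i)))

  Points : Pred Carrier ℓL
  Points z = ∃[ i ] z ≈ point i

  points-dense : JoinDense L Points
  points-dense a b below = f-reflects-≤ λ {i} i∈fa →
    point≤⁻¹ (below (point i) (i , Eq.refl) (point≤ i∈fa))

  points-antiExchange : AntiExchange L Points
  points-antiExchange a x y (i , x≈i) (j , y≈j) x≰a x≤a∨y y≤a∨x =
    Eq.trans x≈i (Eq.trans (point-antiExchange
      (x≰a ∘ trans (reflexive x≈i))
      (exchanged x≈i y≈j x≤a∨y) (exchanged y≈j x≈i y≤a∨x)) (Eq.sym y≈j))
    where
    exchanged : ∀ {x y x′ y′} → x ≈ x′ → y ≈ y′ → x ≤ a ∨ y → x′ ≤ a ∨ y′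
    exchanged x≈x′ y≈y′ x≤a∨y = trans (reflexive (Eq.sym x≈x′)) (trans x≤a∨y
      (∨-least′ L (x≤x∨y a _) (trans (reflexive y≈y′) (y≤x∨y a _))))

-- From points of the lattice to a representing geometry.

module PointsToGeometry
  (em : ∀ {ℓ} → ExcludedMiddle ℓ) {c ℓ₁ ℓ₂} (L : Lattice c ℓ₁ ℓ₂)
  where
  open Lattice L
  open LatticeNotions L

  module _ (complete : IsComplete) (nontrivial : IsNontrivial)
           {P : Pred Carrier ℓL} (dense : JoinDense L P) (antiEx : AntiExchange L P)
           (nonLeast : HasNonLeast L P)
           where

    Point : Set ℓL
    Point = Σ Carrier P

    -- Completeness speaks of predicates on `Carrier`, so the proof of `P z` is quantified away.
    ⋁ : Pred Point ℓL → Carrier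
    ⋁ A = proj₁ (proj₁ (complete λ z → Σ[ z∈P ∈ P z ] (z , z∈P) ∈ A))

    ⋁-upper : ∀ A {x} → x ∈ A → proj₁ x ≤ ⋁ A
    ⋁-upper A {z , z∈P} x∈A = proj₁ (proj₂ (proj₁ (complete _))) z (z∈P , x∈A)

    ⋁-least : ∀ A {b} → (∀ {x} → x ∈ A → proj₁ x ≤ b) → ⋁ A ≤ b
    ⋁-least A {b} ub = proj₂ (proj₂ (proj₁ (complete _))) b λ { z (z∈P , x∈A) → ub x∈A }

    -- A record rather than Lift, so that x is determined by the type below a x.
    record below (a : Carrier) (x : Point) : Set ℓL where
      constructor mk
      field
        isBelow : proj₁ x ≤ a
    open below

    below-mono : ∀ {a b} → a ≤ b → below a ⊆ below b
    below-mono a≤b (mk x≤a) = mk (trans x≤a a≤b)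

    below-reflects-≤ : ∀ {a b} → below a ⊆ below b → a ≤ b
    below-reflects-≤ {a} {b} a⊆b = dense a b λ z z∈P z≤a → isBelow (a⊆b {z , z∈P} (mk z≤a))

    ⋁-below≤ : ∀ a → ⋁ (below a) ≤ a
    ⋁-below≤ a = ⋁-least (below a) isBelow

    -- By density `a` is the join of the points below it; hence `below` and `⋁` are mutually inverse
    -- between `L` and the closed sets.
    ≤⋁-below : ∀ a → a ≤ ⋁ (below a)
    ≤⋁-below a = dense a _ λ z z∈P z≤a → ⋁-upper (below a) {z , z∈P} (mk z≤a)

    ⋁-mono : ∀ A B → A ⊆ B → ⋁ A ≤ ⋁ B
    ⋁-mono A B A⊆B = ⋁-least A (⋁-upper B ∘ A⊆B)

    ⋁-∪≤ : ∀ A B → ⋁ (A ∪ B) ≤ ⋁ A ∨ ⋁ B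
    ⋁-∪≤ A B = ⋁-least (A ∪ B)
      [ (λ x∈A → trans (⋁-upper A x∈A) (x≤x∨y _ _))
      , (λ x∈B → trans (⋁-upper B x∈B) (y≤x∨y _ _)) ]

    somePoint : Point
    somePoint = let x , y , x≉y = nontrivial in decidable-stable em λ none →
      x≉y (antisym (dense x y λ z z∈P _ → ⊥-elim (none (z , z∈P)))
                   (dense y x λ z z∈P _ → ⊥-elim (none (z , z∈P))))

    -- A closed set is determined by its join, so anti-exchange over a closed `A` is anti-exchange
    -- at `⋁ A`. Points are compared by their elements alone, whatever their membership proofs.
    geometry : ConvexGeometry ℓL
    geometry = record
      { X = record
        { Carrier = Point
        ; _≈_ = λ x y → Lift ℓL (proj₁ x ≈ proj₁ y)
        ; isEquivalence = record
          { refl  = lift Eq.refl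
          ; sym   = λ (lift e) → lift (Eq.sym e)
          ; trans = λ (lift e) (lift e′) → lift (Eq.trans e e′)
          }
        }
      ; nonEmpty = somePoint
      ; φ = below ∘ ⋁
      ; φ-resp = λ _ (lift x≈y) (mk x≤a) → mk (trans (reflexive (Eq.sym x≈y)) x≤a)
      ; extensive = λ A x∈A → mk (⋁-upper A x∈A)
      ; monotone = λ A B A⊆B → below-mono (⋁-mono A B A⊆B)
      ; idempotent = λ A → below-mono (⋁-below≤ (⋁ A)) , below-mono (≤⋁-below (⋁ A))
      -- `⋁ ∅` is the least element, and no point is least.
      ; φ-∅ = (λ { {x , x∈P} (mk x≤⋁∅) → ⊥-elim (x≰⋁∅ x∈P x≤⋁∅) }) , λ ()
      -- As `A` is closed, `x ∉ A` means `x ≰ ⋁ A`.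
      ; antiExchange = λ { A (φA⊆A , _) (x , x∈P) (y , y∈P) x≉y (mk x≤) x∉A (mk y≤) →
          x≉y (lift (antiEx (⋁ A) x y x∈P y∈P (x∉A ∘ φA⊆A ∘ mk)
            (trans x≤ (⋁-∪-point≤ A)) (trans y≤ (⋁-∪-point≤ A)))) }
      }
      where
      x≰⋁∅ : ∀ {x} → x ∈ P → ¬ x ≤ ⋁ ∅
      x≰⋁∅ {x} x∈P x≤⋁∅ with y , x≰y ← nonLeast x x∈P =
        x≰y (trans x≤⋁∅ (⋁-least ∅ λ ()))
      ⋁-∪-point≤ : ∀ A {x} → ⋁ (A ∪ λ z → Lift ℓL (proj₁ z ≈ x)) ≤ ⋁ A ∨ x
      ⋁-∪-point≤ A = trans (⋁-∪≤ A _)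
        (∨-least′ L (x≤x∨y _ _)
          (trans (⋁-least _ (reflexive ∘ lower)) (y≤x∨y _ _)))

    represents : LatticeIsomorphic L (closedSets geometry)
    represents = (λ a → below a , below-mono (⋁-below≤ a) , below-mono (≤⋁-below a)) , record
      { isLatticeMonomorphism = record
        { isLatticeHomomorphism = record
          { isRelHomomorphism = record
            { cong = λ a≈b → below-mono (reflexive a≈b) , below-mono (reflexive (Eq.sym a≈b)) }
          ; ∧-homo = λ a b →
                (λ (mk x≤a∧b) → mk (trans x≤a∧b (x∧y≤x a b))
                                , mk (trans x≤a∧b (x∧y≤y a b)))
              , (λ (mk x≤a , mk x≤b) → mk (∧-greatest x≤a x≤b))
          ; ∨-homo = λ a b →
                below-mono (∨-least′ L
                  (trans (≤⋁-below a) (⋁-mono (below a) (below a ∪ below b) inj₁))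
                  (trans (≤⋁-below b) (⋁-mono (below b) (below a ∪ below b) inj₂)))
              , below-mono (trans (⋁-∪≤ (below a) (below b))
                  (∨-least′ L (trans (⋁-below≤ a) (x≤x∨y a b))
                              (trans (⋁-below≤ b) (y≤x∨y a b))))
          }
        ; injective = λ (a⊆b , b⊆a) → antisym (below-reflects-≤ a⊆b) (below-reflects-≤ b⊆a)
        }
      -- The preimage is `⋁ A`, since a closed `A` equals `below (⋁ A)`.
      ; surjective = λ (A , φA⊆A , A⊆φA) → ⋁ A , λ z≈⋁A →
          φA⊆A ∘ below-mono (reflexive z≈⋁A) , below-mono (reflexive (Eq.sym z≈⋁A)) ∘ A⊆φA
      }

    convexity : IsConvexityLattice
    convexity = geometry , represents

theorem3p3 : (∀ {ℓ} → ExcludedMiddle ℓ) →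
    ∀ {c ℓ₁ ℓ₂} (L : Lattice c ℓ₁ ℓ₂) →
    let open Lattice L
        open LatticeNotions L in
    IsAlgebraic → IsNontrivial →
    IsConvexityLattice ⇔
      (IsSpatial ×
       (∀ y u v → IsCompletelyJoinIrreducible u → IsCompletelyJoinIrreducible v →
         y < (y ∨ u) → (y ∨ u) ≈ (y ∨ v) → u ≈ v))
theorem3p3 em L algebraic nontrivial = mk⇔ convexity⇒criterion criterion⇒convexity
  where
  open LatticeNotions L
  convexity⇒criterion : IsConvexityLattice → IsSpatial × IrreducibleExchange L
  convexity⇒criterion (G , iso) =
    spatial points-dense points-antiExchange algebraic ,
    irreducibleExchange points-dense points-antiExchange
    where
    open GeometryToPoints em L G iso
    open PointsToIrreducibles em L
  criterion⇒convexity : IsSpatial × IrreducibleExchange L → IsConvexityLattice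
  criterion⇒convexity (spatial , exchange) =
    PointsToGeometry.convexity em L (proj₁ algebraic) nontrivial
      (spatial⇒dense L spatial) (exchange⇒antiExchange L exchange)
      (irreducible-nonLeast L)
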